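{- The following hold for every positive integer $k$: (a) Every $k$-growth system is $k$-extendible. (b) Every $k$-matchoid is a $k$-growth system.
   Context: An independence system $(S,\mathcal{I})$ is a finite set $S$ with a nonempty downward-closed family $\mathcal{I}\subseteq2^S$ of independent sets. A basis of $X\subseteq S$ is an inclusion-wise maximal independent subset of $X$. $k$-growth: for all $X\subseteq S$ and all $I\in\mathcal{I}$ there is a partition $(Q,Z)$ of $I\setminus X$ with $|Z|\le k|X\setminus I|$ such that $P\cup Q\in\mathcal{I}$ for every basis $P$ of $X$. $k$-extendible: for every $A\subseteq B\in\mathcal{I}$ and $e\in S\setminus B$ with $A\cup\{e\}\in\mathcal{I}$, there is $Z\subseteq B\setminus A$ with $|Z|\le k$ and $(B\cup\{e\})\setminus Z\in\mathcal{I}$. $k$-matchoid: there are matroids $(S_i,\mathcal{I}_i)$, $i\in[N]$, with $S=\bigcup_iS_i$, each $e\in S$ belonging to at most $k$ of the sets $S_i$, and $\mathcal{I}=\{F\subseteq S:F\cap S_i\in\mathcal{I}_i\ \forall i\in[N]\}$. -}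

module Defs where

open import Data.Fin.Base using (Fin)
open import Data.Fin.Subset
  using (Subset; _∈_; _∉_; _⊆_; _∪_; _∩_; _─_; ⁅_⁆; ⋃; ∣_∣; Empty)
open import Data.List.Base as List using ()
open import Data.Nat.Base using (ℕ; _*_; _≤_; _<_)
open import Data.Product.Base using (∃-syntax; _×_)
open import Data.Vec.Base as Vec using ()
open import Function.Bundles using (_⇔_)
open import Level using (0ℓ)
open import Relation.Binary.PropositionalEquality using (_≡_)
open import Relation.Unary using (Pred; Decidable)

-- Finite sets are subsets of an ambient Fin n, so that the matroids forming a
-- matchoid can have different, overlapping ground sets.  As 2^S is finite, a
-- family of subsets is taken to have decidable membership.
record IndependenceSystem (n : ℕ) : Set₁ where
  field
    ground   : Subset n
    Indep    : Pred (Subset n) 0ℓ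
    indep?   : Decidable Indep
    indep⊆   : ∀ {I} → Indep I → I ⊆ ground
    nonempty : ∃[ I ] Indep I
    downward : ∀ {I J} → J ⊆ I → Indep I → Indep J

module _ {n : ℕ} (𝓢 : IndependenceSystem n) where
  open IndependenceSystem 𝓢

  record IsBasis (P X : Subset n) : Set where
    field
      indep   : Indep P
      subset  : P ⊆ X
      maximal : ∀ J → Indep J → J ⊆ X → P ⊆ J → J ≡ P

  IsMatroid : Set
  IsMatroid = ∀ I J → Indep I → Indep J → ∣ I ∣ < ∣ J ∣ →
              ∃[ e ] e ∈ J × e ∉ I × Indep (I ∪ ⁅ e ⁆)

  -- Parts of a partition may be empty.
  IsPartition : (Q Z Y : Subset n) → Set
  IsPartition Q Z Y = Q ∪ Z ≡ Y × Empty (Q ∩ Z)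

  IsGrowth : ℕ → Set
  IsGrowth k = ∀ X I → X ⊆ ground → Indep I →
    ∃[ Q ] ∃[ Z ] IsPartition Q Z (I ─ X)
                × ∣ Z ∣ ≤ k * ∣ X ─ I ∣
                × (∀ P → IsBasis P X → Indep (P ∪ Q))

  IsExtendible : ℕ → Set
  IsExtendible k = ∀ A B e → A ⊆ B → Indep B → e ∈ ground → e ∉ B →
    Indep (A ∪ ⁅ e ⁆) →
    ∃[ Z ] Z ⊆ B ─ A × ∣ Z ∣ ≤ k × Indep ((B ∪ ⁅ e ⁆) ─ Z)

record Matroid (n : ℕ) : Set₁ where
  field
    system    : IndependenceSystem n
    isMatroid : IsMatroid system

  open IndependenceSystem system public

-- The set of indices i with e ∈ S i.
indicesAt : ∀ {n N} → (Fin N → Subset n) → Fin n → Subset N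
indicesAt S e = Vec.tabulate λ i → Vec.lookup (S i) e

record IsMatchoid {n : ℕ} (𝓢 : IndependenceSystem n) (k : ℕ) : Set₁ where
  open IndependenceSystem 𝓢

  field
    N : ℕ
    M : Fin N → Matroid n

  Sᵢ : Fin N → Subset n
  Sᵢ i = Matroid.ground (M i)

  field
    cover  : ground ≡ ⋃ (List.tabulate Sᵢ)
    atMost : ∀ e → e ∈ ground → ∣ indicesAt Sᵢ e ∣ ≤ k
    indep⇔ : ∀ F → Indep F ⇔ (F ⊆ ground × (∀ i → Matroid.Indep (M i) (F ∩ Sᵢ i)))

{-# OPTIONS --safe #-}

-- (a) Apply growth to X = A ∪ {e} and I = B: the only basis of X is X itself,
-- I ─ X = B ─ A and X ─ I = {e}.
--
-- (b) In a matroid, let B now be a largest independent subset of X, extend it by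
-- elements of I to an independent T with |I| ≤ |T|, and put Q = T ─ X.  Then
-- |(I ─ X) ─ Q| ≤ |X ─ I|.  If P ⊆ X is independent, augmenting P from T gives
-- an independent R with |T| ≤ |R|; at most |B| of its elements lie in X, and
-- those outside X lie in Q, so R contains all of Q.  In a matchoid the sets to
-- discard from I ─ X are collected over all matroids; as each element of X ─ I
-- lies in at most k ground sets, their total size is at most k |X ─ I|.
module Submission where

open import Data.Bool.Base using (Bool; true; false; _∧_; if_then_else_)
open import Data.Fin.Base using (Fin; zero; suc)
open import Data.Fin.Subset
  using (Subset; inside; outside; _∈_; _∉_; _⊆_; _⊃_; ⊥; _∪_; _∩_; _─_; ⁅_⁆; ⋃; ∣_∣)
open import Data.Fin.Subset.Induction using (⊃-wellFounded; Acc; acc)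
open import Data.Fin.Subset.Properties
open import Data.List.Base as List using ()
open import Data.Nat.Base
open import Data.Nat.Properties
open import Algebra.Properties.Semiring.Sum +-*-semiring
  using (sum; ∑-comm; *-distribˡ-sum; sum-cong-≗; sum-replicate-zero)
open import Data.Product.Base using (∃-syntax; _×_; _,_; proj₁; proj₂)
open import Data.Sum.Base using (inj₁; inj₂; [_,_]′)
open import Data.Vec.Base using ([]; _∷_; here; there; lookup)
open import Data.Vec.Properties using (lookup∘tabulate; lookup-zipWith; lookup⇒[]=)
open import Function.Base using (_∘_)
open import Function.Bundles using (Equivalence)
open import Level using (0ℓ)
open import Relation.Binary.PropositionalEquality
open import Relation.Nullary using (yes; no; contradiction)
open import Relation.Nullary.Decidable using (_×-dec_)
open import Relation.Unary using (Pred; Decidable)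

open import Defs

private
  variable
    m n : ℕ
    p q r s : Subset n

-- Inclusions and cardinalities of finite subsets.

x∈p─q⇒x∉q : ∀ (p q : Subset n) {x} → x ∈ p ─ q → x ∉ q
x∈p─q⇒x∉q (_ ∷ p) (inside  ∷ q) (there x∈) (there x∈q) = x∈p─q⇒x∉q p q x∈ x∈q
x∈p─q⇒x∉q (_ ∷ p) (outside ∷ q) (there x∈) (there x∈q) = x∈p─q⇒x∉q p q x∈ x∈q

∪-lub : p ⊆ r → q ⊆ r → p ∪ q ⊆ r
∪-lub p⊆r q⊆r x∈ = [ p⊆r , q⊆r ]′ (x∈p∪q⁻ _ _ x∈)

∩-glb : r ⊆ p → r ⊆ q → r ⊆ p ∩ q
∩-glb r⊆p r⊆q x∈ = x∈p∩q⁺ (r⊆p x∈ , r⊆q x∈)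

p∪q⊆r∪s : p ⊆ r → q ⊆ s → p ∪ q ⊆ r ∪ s
p∪q⊆r∪s {r = r} {s = s} p⊆r q⊆s = ∪-lub (p⊆p∪q s ∘ p⊆r) (q⊆p∪q r s ∘ q⊆s)

∪-─-⊆ : ∀ (p q r : Subset n) → p ⊆ q ∪ r → p ─ q ⊆ r ─ q
∪-─-⊆ p q r p⊆ x∈ with x∈p∪q⁻ q r (p⊆ (p─q⊆p p q x∈))
... | inj₁ x∈q = contradiction x∈q (x∈p─q⇒x∉q p q x∈)
... | inj₂ x∈r = x∈p∧x∉q⇒x∈p─q x∈r (x∈p─q⇒x∉q p q x∈)

p⊆q∪[p─q] : ∀ (p q : Subset n) → p ⊆ q ∪ (p ─ q)
p⊆q∪[p─q] p q {x} x∈p with x ∈? q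
... | yes x∈q = p⊆p∪q (p ─ q) x∈q
... | no  x∉q = q⊆p∪q q (p ─ q) (x∈p∧x∉q⇒x∈p─q x∈p x∉q)

∣p─q∣+∣p∩q∣≡∣p∣ : ∀ (p q : Subset n) → ∣ p ─ q ∣ + ∣ p ∩ q ∣ ≡ ∣ p ∣
∣p─q∣+∣p∩q∣≡∣p∣ []            []            = refl
∣p─q∣+∣p∩q∣≡∣p∣ (inside  ∷ p) (inside  ∷ q) =
  trans (+-suc _ _) (cong suc (∣p─q∣+∣p∩q∣≡∣p∣ p q))
∣p─q∣+∣p∩q∣≡∣p∣ (inside  ∷ p) (outside ∷ q) = cong suc (∣p─q∣+∣p∩q∣≡∣p∣ p q)
∣p─q∣+∣p∩q∣≡∣p∣ (outside ∷ p) (inside  ∷ q) = ∣p─q∣+∣p∩q∣≡∣p∣ p q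
∣p─q∣+∣p∩q∣≡∣p∣ (outside ∷ p) (outside ∷ q) = ∣p─q∣+∣p∩q∣≡∣p∣ p q

∣p∪q∣≤∣p∣+∣q∣ : ∀ (p q : Subset n) → ∣ p ∪ q ∣ ≤ ∣ p ∣ + ∣ q ∣
∣p∪q∣≤∣p∣+∣q∣ []            []            = z≤n
∣p∪q∣≤∣p∣+∣q∣ (inside  ∷ p) (inside  ∷ q) =
  s≤s (≤-trans (∣p∪q∣≤∣p∣+∣q∣ p q) (+-monoʳ-≤ ∣ p ∣ (n≤1+n _)))
∣p∪q∣≤∣p∣+∣q∣ (inside  ∷ p) (outside ∷ q) = s≤s (∣p∪q∣≤∣p∣+∣q∣ p q)
∣p∪q∣≤∣p∣+∣q∣ (outside ∷ p) (inside  ∷ q) =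
  ≤-trans (s≤s (∣p∪q∣≤∣p∣+∣q∣ p q)) (≤-reflexive (sym (+-suc _ _)))
∣p∪q∣≤∣p∣+∣q∣ (outside ∷ p) (outside ∷ q) = ∣p∪q∣≤∣p∣+∣q∣ p q

p⊆q∧∣q∣≤∣p∣⇒q⊆p : p ⊆ q → ∣ q ∣ ≤ ∣ p ∣ → q ⊆ p
p⊆q∧∣q∣≤∣p∣⇒q⊆p {p = p} p⊆q ∣q∣≤∣p∣ {x} x∈q with x ∈? p
... | yes x∈p = x∈p
... | no  x∉p = contradiction (p⊂q⇒∣p∣<∣q∣ (p⊆q , x , x∈q , x∉p)) (≤⇒≯ ∣q∣≤∣p∣)

largestSubset : ∀ {P : Pred (Subset n) 0ℓ} → Decidable P → ∀ p → P p →
  ∃[ q ] P q × (∀ r → P r → ∣ r ∣ ≤ ∣ q ∣)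
largestSubset {n = n} {P} P? p Pp = go n p Pp (m≤n+m n ∣ p ∣)
  where
  -- `m` is fuel: every strictly larger witness uses up one unit, and at fuel zero `p` already has
  -- size `n`, the largest possible.
  go : ∀ m p → P p → n ≤ ∣ p ∣ + m → ∃[ q ] P q × (∀ r → P r → ∣ r ∣ ≤ ∣ q ∣)
  go zero p Pp n≤ = p , Pp , λ r _ →
    ≤-trans (∣p∣≤n r) (≤-trans n≤ (≤-reflexive (+-identityʳ ∣ p ∣)))
  go (suc m) p Pp n≤ with anySubset? (λ r → P? r ×-dec (∣ p ∣ <? ∣ r ∣))
  ... | yes (r , Pr , p<r) =
    go m r Pr (≤-trans n≤ (≤-trans (≤-reflexive (+-suc _ m)) (+-monoˡ-≤ m p<r)))
  ... | no ∄larger = p , Pp , λ r Pr → ≮⇒≥ λ p<r → ∄larger (r , Pr , p<r)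

-- Sums over indices and double counting.

sum-mono-≤ : ∀ {f g : Fin n → ℕ} → (∀ i → f i ≤ g i) → sum f ≤ sum g
sum-mono-≤ {zero}  f≤g = z≤n
sum-mono-≤ {suc n} f≤g = +-mono-≤ (f≤g zero) (sum-mono-≤ (f≤g ∘ suc))

∣⋃∣≤sum : ∀ (S : Fin m → Subset n) → ∣ ⋃ (List.tabulate S) ∣ ≤ sum (λ i → ∣ S i ∣)
∣⋃∣≤sum {zero}  {n} S = ≤-reflexive (∣⊥∣≡0 n)
∣⋃∣≤sum {suc m} S =
  ≤-trans (∣p∪q∣≤∣p∣+∣q∣ (S zero) _) (+-monoʳ-≤ ∣ S zero ∣ (∣⋃∣≤sum (S ∘ suc)))

⊆⋃ : ∀ (S : Fin m → Subset n) i → S i ⊆ ⋃ (List.tabulate S)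
⊆⋃ S zero    x∈ = p⊆p∪q _ x∈
⊆⋃ S (suc i) x∈ = q⊆p∪q (S zero) _ (⊆⋃ (S ∘ suc) i x∈)

indicator : Subset n → Fin n → ℕ
indicator p x = if lookup p x then 1 else 0

∣p∣≡sum : ∀ (p : Subset n) → ∣ p ∣ ≡ sum (indicator p)
∣p∣≡sum []            = refl
∣p∣≡sum (inside  ∷ p) = cong suc (∣p∣≡sum p)
∣p∣≡sum (outside ∷ p) = ∣p∣≡sum p

-- Count the pairs (i , x) with x ∈ Y ∩ S i by x instead of by i.
sum-∣Y∩Sᵢ∣≤k*∣Y∣ : ∀ k (Y : Subset n) (S : Fin m → Subset n) →
  (∀ x → x ∈ Y → ∣ indicesAt S x ∣ ≤ k) → sum (λ i → ∣ Y ∩ S i ∣) ≤ k * ∣ Y ∣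
sum-∣Y∩Sᵢ∣≤k*∣Y∣ {m = m} k Y S atMost = begin
  sum (λ i → ∣ Y ∩ S i ∣)                      ≡⟨ sum-cong-≗ (λ i → ∣p∣≡sum (Y ∩ S i)) ⟩
  sum (λ i → sum (indicator (Y ∩ S i)))        ≡⟨ ∑-comm (λ i → indicator (Y ∩ S i)) ⟩
  sum (λ x → sum (λ i → indicator (Y ∩ S i) x)) ≤⟨ sum-mono-≤ row ⟩
  sum (λ x → k * indicator Y x)                ≡⟨ *-distribˡ-sum k (indicator Y) ⟨
  k * sum (indicator Y)                        ≡⟨ cong (k *_) (∣p∣≡sum Y) ⟨
  k * ∣ Y ∣                                    ∎
  where
  open ≤-Reasoning

  toBit : Bool → ℕ
  toBit b = if b then 1 else 0

  row : ∀ x → sum (λ i → indicator (Y ∩ S i) x) ≤ k * indicator Y x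
  row x = ≤-trans
    (≤-reflexive (sum-cong-≗ λ i → cong toBit (lookup-zipWith _∧_ x Y (S i))))
    masked
    where
    masked : sum (λ i → toBit (lookup Y x ∧ lookup (S i) x)) ≤ k * toBit (lookup Y x)
    -- Fixing this bit makes the conjunctions compute: for `x` outside `Y` all summands vanish, and
    -- otherwise the sum counts the indices `i` with `x ∈ S i`.
    masked with lookup Y x in eq
    ... | false = ≤-trans (≤-reflexive (sum-replicate-zero m)) z≤n
    ... | true  = begin
      sum (λ i → toBit (lookup (S i) x))  ≡⟨ sum-cong-≗ {m} (λ i → cong toBit (lookup∘tabulate (λ j → lookup (S j) x) i)) ⟨
      sum (indicator (indicesAt S x))     ≡⟨ ∣p∣≡sum (indicesAt S x) ⟨
      ∣ indicesAt S x ∣                   ≤⟨ atMost x (lookup⇒[]= x Y eq) ⟩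
      k                                   ≡⟨ *-identityʳ k ⟨
      k * 1                               ∎

-- Augmentation and growth in a single matroid.

module _ {n : ℕ} (𝓜 : Matroid n) where
  open Matroid 𝓜

  -- Iterated exchange: while `I` is smaller than `J`, it gains an element of `J`. The recursion is
  -- well founded because `I` grows strictly inside a finite set.
  augment : ∀ {I J} → Indep I → Indep J →
    ∃[ R ] I ⊆ R × R ⊆ I ∪ J × Indep R × ∣ J ∣ ≤ ∣ R ∣
  augment {I₀} {J} indepI₀ indepJ = go I₀ (⊃-wellFounded I₀) indepI₀
    where
    go : ∀ I → Acc _⊃_ I → Indep I →
      ∃[ R ] I ⊆ R × R ⊆ I ∪ J × Indep R × ∣ J ∣ ≤ ∣ R ∣
    go I (acc rec) indepI with ∣ I ∣ <? ∣ J ∣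
    ... | no I≮J = I , ⊆-refl , p⊆p∪q J , indepI , ≮⇒≥ I≮J
    ... | yes I<J with isMatroid I J indepI indepJ I<J
    ...   | e , e∈J , e∉I , indepIe
          with go (I ∪ ⁅ e ⁆)
                  (rec (p⊆p∪q ⁅ e ⁆ , e , q⊆p∪q I ⁅ e ⁆ (x∈⁅x⁆ e) , e∉I)) indepIe
    ...     | R , Ie⊆R , R⊆ , indepR , J≤R =
      R , Ie⊆R ∘ p⊆p∪q ⁅ e ⁆ , ∪-lub (p∪q⊆r∪s ⊆-refl e⊆J) (q⊆p∪q I J) ∘ R⊆ , indepR , J≤R
      where
      e⊆J : ⁅ e ⁆ ⊆ J
      e⊆J x∈ = subst (_∈ J) (sym (x∈⁅y⁆⇒x≡y e x∈)) e∈J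

  -- `P` ranges over all independent subsets of `X`, since a basis of a set in a matchoid meets a
  -- single ground set in an independent set that may fail to be maximal there. One `Q` has to serve
  -- every such `P`.
  matroid-growth : ∀ X {I} → Indep I →
    ∃[ Q ] ∣ I ─ X ─ Q ∣ ≤ ∣ X ─ I ∣
         × (∀ P → Indep P → P ⊆ X → Indep (P ∪ Q))
  matroid-growth X {I} indepI
    with largestSubset (λ J → indep? J ×-dec (J ⊆? X))
           ⊥ (downward ⊥⊆ indepI , ⊥⊆)
  ... | B , (indepB , B⊆X) , B-largest with augment indepB indepI
  ...   | T , B⊆T , T⊆B∪I , indepT , I≤T = Q , discarded , kept
    where
    open ≤-Reasoning

    Q : Subset n
    Q = T ─ X

    Q⊆I─X : Q ⊆ I ─ X
    Q⊆I─X = ∪-─-⊆ T X I (p∪q⊆r∪s B⊆X ⊆-refl ∘ T⊆B∪I)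

    -- With `∣ Q ∣ + ∣ I ∩ X ∣` added, the left side is at most `∣ I ∣`, as `Q ⊆ I ─ X`, and the
    -- right side is `∣ Q ∣ + ∣ X ∣`, which bounds `∣ T ∣`.
    discarded : ∣ I ─ X ─ Q ∣ ≤ ∣ X ─ I ∣
    discarded = +-cancelʳ-≤ (∣ Q ∣ + ∣ I ∩ X ∣) _ _ (begin
      ∣ I ─ X ─ Q ∣ + (∣ Q ∣ + ∣ I ∩ X ∣)          ≡⟨ +-assoc ∣ I ─ X ─ Q ∣ _ _ ⟨
      ∣ I ─ X ─ Q ∣ + ∣ Q ∣ + ∣ I ∩ X ∣
        ≤⟨ +-monoˡ-≤ _ (+-monoʳ-≤ ∣ I ─ X ─ Q ∣ (p⊆q⇒∣p∣≤∣q∣ (∩-glb Q⊆I─X ⊆-refl))) ⟩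
      ∣ I ─ X ─ Q ∣ + ∣ (I ─ X) ∩ Q ∣ + ∣ I ∩ X ∣  ≡⟨ cong (_+ ∣ I ∩ X ∣) (∣p─q∣+∣p∩q∣≡∣p∣ (I ─ X) Q) ⟩
      ∣ I ─ X ∣ + ∣ I ∩ X ∣                        ≡⟨ ∣p─q∣+∣p∩q∣≡∣p∣ I X ⟩
      ∣ I ∣                                        ≤⟨ I≤T ⟩
      ∣ T ∣                                        ≡⟨ ∣p─q∣+∣p∩q∣≡∣p∣ T X ⟨
      ∣ Q ∣ + ∣ T ∩ X ∣                            ≤⟨ +-monoʳ-≤ ∣ Q ∣ (∣p∩q∣≤∣q∣ T X) ⟩
      ∣ Q ∣ + ∣ X ∣                                ≡⟨ cong (∣ Q ∣ +_) (∣p─q∣+∣p∩q∣≡∣p∣ X I) ⟨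
      ∣ Q ∣ + (∣ X ─ I ∣ + ∣ X ∩ I ∣)              ≡⟨ +-comm ∣ Q ∣ _ ⟩
      ∣ X ─ I ∣ + ∣ X ∩ I ∣ + ∣ Q ∣                ≡⟨ +-assoc ∣ X ─ I ∣ _ _ ⟩
      ∣ X ─ I ∣ + (∣ X ∩ I ∣ + ∣ Q ∣)              ≡⟨ cong (∣ X ─ I ∣ +_) (+-comm ∣ X ∩ I ∣ _) ⟩
      ∣ X ─ I ∣ + (∣ Q ∣ + ∣ X ∩ I ∣)              ≡⟨ cong (λ p → ∣ X ─ I ∣ + (∣ Q ∣ + ∣ p ∣)) (∩-comm X I) ⟩
      ∣ X ─ I ∣ + (∣ Q ∣ + ∣ I ∩ X ∣)              ∎)

    kept : ∀ P → Indep P → P ⊆ X → Indep (P ∪ Q)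
    kept P indepP P⊆X with augment indepP indepT
    ... | R , P⊆R , R⊆P∪T , indepR , T≤R = downward (∪-lub P⊆R Q⊆R) indepR
      where
      R─X⊆Q : R ─ X ⊆ Q
      R─X⊆Q = ∪-─-⊆ R X T (p∪q⊆r∪s P⊆X ⊆-refl ∘ R⊆P∪T)

      -- `T ∩ X` contains `B`, while `R ∩ X` is an independent subset of `X` and so no larger than
      -- `B`. Hence `∣ T ∣ ≤ ∣ R ∣` passes to the parts outside `X`.
      ∣Q∣≤∣R─X∣ : ∣ Q ∣ ≤ ∣ R ─ X ∣
      ∣Q∣≤∣R─X∣ = +-cancelʳ-≤ ∣ B ∣ _ _ (begin
        ∣ Q ∣ + ∣ B ∣          ≤⟨ +-monoʳ-≤ ∣ Q ∣ (p⊆q⇒∣p∣≤∣q∣ (∩-glb B⊆T B⊆X)) ⟩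
        ∣ Q ∣ + ∣ T ∩ X ∣      ≡⟨ ∣p─q∣+∣p∩q∣≡∣p∣ T X ⟩
        ∣ T ∣                  ≤⟨ T≤R ⟩
        ∣ R ∣                  ≡⟨ ∣p─q∣+∣p∩q∣≡∣p∣ R X ⟨
        ∣ R ─ X ∣ + ∣ R ∩ X ∣
          ≤⟨ +-monoʳ-≤ ∣ R ─ X ∣ (B-largest _ (downward (p∩q⊆p R X) indepR , p∩q⊆q R X)) ⟩
        ∣ R ─ X ∣ + ∣ B ∣      ∎)

      Q⊆R : Q ⊆ R
      Q⊆R = p─q⊆p R X ∘ p⊆q∧∣q∣≤∣p∣⇒q⊆p R─X⊆Q ∣Q∣≤∣R─X∣

-- From growth to extendibility.

growth⇒extendible : ∀ k (𝓢 : IndependenceSystem n) → IsGrowth 𝓢 k → IsExtendible 𝓢 k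
growth⇒extendible k 𝓢 growth A B e A⊆B indepB _ _ indepAe
  with growth (A ∪ ⁅ e ⁆) B (IndependenceSystem.indep⊆ 𝓢 indepAe) indepB
... | Q , Z , (Q∪Z≡B─X , _) , Z≤ , extend =
  Z , Z⊆B─A , ∣Z∣≤k , downward B∪e─Z⊆X∪Q (extend X X-basis)
  where
  open IndependenceSystem 𝓢

  X : Subset _
  X = A ∪ ⁅ e ⁆

  X-basis : IsBasis 𝓢 X X
  X-basis = record
    { indep   = indepAe
    ; subset  = ⊆-refl
    ; maximal = λ J _ J⊆X X⊆J → ⊆-antisym J⊆X X⊆J
    }

  Z⊆B─A : Z ⊆ B ─ A
  Z⊆B─A x∈Z = x∈p∧x∉q⇒x∈p─q (p─q⊆p B X x∈B─X) (x∈p─q⇒x∉q B X x∈B─X ∘ p⊆p∪q ⁅ e ⁆)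
    where
    x∈B─X = subst (_ ∈_) Q∪Z≡B─X (q⊆p∪q Q Z x∈Z)

  X─B⊆e : X ─ B ⊆ ⁅ e ⁆
  X─B⊆e = p─q⊆p ⁅ e ⁆ B ∘ ∪-─-⊆ X B ⁅ e ⁆ (p∪q⊆r∪s A⊆B ⊆-refl)

  ∣Z∣≤k : ∣ Z ∣ ≤ k
  ∣Z∣≤k = begin
    ∣ Z ∣          ≤⟨ Z≤ ⟩
    k * ∣ X ─ B ∣  ≤⟨ *-monoʳ-≤ k (p⊆q⇒∣p∣≤∣q∣ X─B⊆e) ⟩
    k * ∣ ⁅ e ⁆ ∣  ≡⟨ cong (k *_) (∣⁅x⁆∣≡1 e) ⟩
    k * 1          ≡⟨ *-identityʳ k ⟩
    k              ∎
    where open ≤-Reasoning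

  B∪e⊆X∪[Q∪Z] : B ∪ ⁅ e ⁆ ⊆ X ∪ (Q ∪ Z)
  B∪e⊆X∪[Q∪Z] rewrite Q∪Z≡B─X =
    ∪-lub (p⊆q∪[p─q] B X) (p⊆p∪q (B ─ X) ∘ q⊆p∪q A ⁅ e ⁆)

  B∪e─Z⊆X∪Q : (B ∪ ⁅ e ⁆) ─ Z ⊆ X ∪ Q
  B∪e─Z⊆X∪Q = p─q⊆p (X ∪ Q) Z ∘ ∪-─-⊆ (B ∪ ⁅ e ⁆) Z (X ∪ Q)
    -- Regroups `X ∪ (Q ∪ Z)` as `Z ∪ (X ∪ Q)`, so that removing `Z` leaves only elements of
    -- `X ∪ Q`.
    (∪-lub (q⊆p∪q Z _ ∘ p⊆p∪q Q)
           (∪-lub (q⊆p∪q Z _ ∘ q⊆p∪q X Q) (p⊆p∪q _)) ∘ B∪e⊆X∪[Q∪Z])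

-- From matroids to matchoids.

─∩-partition : ∀ (𝓢 : IndependenceSystem n) p q → IsPartition 𝓢 (p ─ q) (p ∩ q) p
─∩-partition 𝓢 p q = ⊆-antisym (∪-lub (p─q⊆p p q) (p∩q⊆p p q)) split , λ (x , x∈) →
  let x∈─ , x∈∩ = x∈p∩q⁻ (p ─ q) (p ∩ q) x∈
  in x∈p─q⇒x∉q p q x∈─ (p∩q⊆q p q x∈∩)
  where
  split : p ⊆ (p ─ q) ∪ (p ∩ q)
  split {x} x∈p with x ∈? q
  ... | yes x∈q = q⊆p∪q (p ─ q) _ (x∈p∩q⁺ (x∈p , x∈q))
  ... | no  x∉q = p⊆p∪q (p ∩ q) (x∈p∧x∉q⇒x∈p─q x∈p x∉q)

∩-─-⊆ : ∀ (p q r : Subset n) → (p ∩ r) ─ (q ∩ r) ⊆ (p ─ q) ∩ r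
∩-─-⊆ p q r x∈ =
  let x∈p , x∈r = x∈p∩q⁻ p r (p─q⊆p (p ∩ r) (q ∩ r) x∈)
      x∉q∩r     = x∈p─q⇒x∉q (p ∩ r) (q ∩ r) x∈
  in x∈p∩q⁺ (x∈p∧x∉q⇒x∈p─q x∈p (λ x∈q → x∉q∩r (x∈p∩q⁺ (x∈q , x∈r))) , x∈r)

─-∩-⊆ : ∀ (p q r : Subset n) → (p ─ q) ∩ r ⊆ (p ∩ r) ─ (q ∩ r)
─-∩-⊆ p q r x∈ =
  let x∈p─q , x∈r = x∈p∩q⁻ (p ─ q) r x∈
  in x∈p∧x∉q⇒x∈p─q (x∈p∩q⁺ (p─q⊆p p q x∈p─q , x∈r))
                   (x∈p─q⇒x∉q p q x∈p─q ∘ p∩q⊆p q r)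

matchoid⇒growth : ∀ k (𝓢 : IndependenceSystem n) → IsMatchoid 𝓢 k → IsGrowth 𝓢 k
matchoid⇒growth {n} k 𝓢 matchoid X I X⊆ground indepI =
  -- Cutting `I ─ X` along `W` gives a partition by construction.
  I ─ X ─ W , (I ─ X) ∩ W , ─∩-partition 𝓢 (I ─ X) W , ∣Z∣≤ , extend
  where
  open IndependenceSystem 𝓢
  open IsMatchoid matchoid
  open module Mᵢ (i : Fin N) = Matroid (M i) using () renaming (Indep to Indepᵢ; downward to downwardᵢ)

  restrict : ∀ {F} → Indep F → ∀ i → Indepᵢ i (F ∩ Sᵢ i)
  restrict indepF = proj₂ (Equivalence.to (indep⇔ _) indepF)

  growthᵢ : ∀ i → _
  growthᵢ i = matroid-growth (M i) (X ∩ Sᵢ i) (restrict indepI i)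

  Qᵢ Zᵢ : Fin N → Subset n
  Qᵢ i = proj₁ (growthᵢ i)
  Zᵢ i = (I ∩ Sᵢ i) ─ (X ∩ Sᵢ i) ─ Qᵢ i

  -- An element of `I ─ X` survives only if no matroid discards it.
  W : Subset n
  W = ⋃ (List.tabulate Zᵢ)

  ∣Zᵢ∣≤ : ∀ i → ∣ Zᵢ i ∣ ≤ ∣ (X ─ I) ∩ Sᵢ i ∣
  ∣Zᵢ∣≤ i = ≤-trans (proj₁ (proj₂ (growthᵢ i))) (p⊆q⇒∣p∣≤∣q∣ (∩-─-⊆ X I (Sᵢ i)))

  ∣Z∣≤ : ∣ (I ─ X) ∩ W ∣ ≤ k * ∣ X ─ I ∣
  ∣Z∣≤ = begin
    ∣ (I ─ X) ∩ W ∣                  ≤⟨ ∣p∩q∣≤∣q∣ (I ─ X) W ⟩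
    ∣ W ∣                            ≤⟨ ∣⋃∣≤sum Zᵢ ⟩
    sum (λ i → ∣ Zᵢ i ∣)             ≤⟨ sum-mono-≤ ∣Zᵢ∣≤ ⟩
    sum (λ i → ∣ (X ─ I) ∩ Sᵢ i ∣)
      ≤⟨ sum-∣Y∩Sᵢ∣≤k*∣Y∣ k (X ─ I) Sᵢ (λ x → atMost x ∘ X⊆ground ∘ p─q⊆p X I) ⟩
    k * ∣ X ─ I ∣                    ∎
    where open ≤-Reasoning

  Q∩Sᵢ⊆Qᵢ : ∀ i → (I ─ X ─ W) ∩ Sᵢ i ⊆ Qᵢ i
  Q∩Sᵢ⊆Qᵢ i {x} x∈ with x ∈? Qᵢ i
  ... | yes x∈Qᵢ = x∈Qᵢ
  -- An element of `Sᵢ i` outside `Qᵢ i` would have been discarded by the `i`-th matroid, hence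
  -- would lie in `W`.
  ... | no  x∉Qᵢ = contradiction (⊆⋃ Zᵢ i (x∈p∧x∉q⇒x∈p─q x∈Iᵢ─Xᵢ x∉Qᵢ))
                                 (x∈p─q⇒x∉q (I ─ X) W x∈Q)
    where
    x∈Q : x ∈ I ─ X ─ W
    x∈Q = p∩q⊆p _ (Sᵢ i) x∈

    x∈Iᵢ─Xᵢ : x ∈ (I ∩ Sᵢ i) ─ (X ∩ Sᵢ i)
    x∈Iᵢ─Xᵢ = ─-∩-⊆ I X (Sᵢ i) (x∈p∩q⁺ (p─q⊆p (I ─ X) W x∈Q , p∩q⊆q _ (Sᵢ i) x∈))

  extend : ∀ P → IsBasis 𝓢 P X → Indep (P ∪ (I ─ X ─ W))
  -- On each `Sᵢ i` the set `P ∪ (I ─ X ─ W)` lies inside `(P ∩ Sᵢ i) ∪ Qᵢ i`, which is independent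
  -- by growth in the `i`-th matroid.
  extend P basis = Equivalence.from (indep⇔ _) (P∪Q⊆ground , λ i →
    downwardᵢ i
      (⊆-trans (⊆-reflexive (∩-distribʳ-∪ (Sᵢ i) P _)) (p∪q⊆r∪s ⊆-refl (Q∩Sᵢ⊆Qᵢ i)))
      (proj₂ (proj₂ (growthᵢ i)) (P ∩ Sᵢ i) (restrict indep i)
        (∩-glb (subset ∘ p∩q⊆p P (Sᵢ i)) (p∩q⊆q P (Sᵢ i)))))
    where
    open IsBasis basis

    P∪Q⊆ground : P ∪ (I ─ X ─ W) ⊆ ground
    P∪Q⊆ground = ∪-lub (indep⊆ indep) (indep⊆ indepI ∘ p─q⊆p I X ∘ p─q⊆p (I ─ X) W)

theorem10 : ∀ (k : ℕ) → k ≥ 1 →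
    (∀ {n} (𝓢 : IndependenceSystem n) → IsGrowth 𝓢 k → IsExtendible 𝓢 k)
    × (∀ {n} (𝓢 : IndependenceSystem n) → IsMatchoid 𝓢 k → IsGrowth 𝓢 k)
theorem10 k _ = growth⇒extendible k , matchoid⇒growth k
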